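{- For all $a,n\in\mathbb{N}$, we have $$W_{3a}(3n-1)\equiv 0\pmod 3\quad\text{and}\quad W_{3a-1}(3n-1)\equiv 0\pmod 3.$$
   Context: $\mathbb{N}$ denotes the positive integers. For integers $n\ge t\ge 0$, define $$h(n,t)=\frac{(2n+1)\,(n+t)!}{(2t+1)!\,(n-t)!},$$ and for non-negative integers $a,n$ define $$W_a(n)=\sum_{\substack{t_1,t_2\ge 0\\ t_1+t_2=2a}}\ \sum_{\substack{n_1\ge t_1,\ n_2\ge t_2\\ \frac{n_1^2+n_1+n_2^2+n_2}{2}=n}}(-1)^{n_1+n_2}h(n_1,t_1)h(n_2,t_2),$$ where $t_1,t_2,n_1,n_2$ are integers. (The values $h(n,t)$ are integers.) -}

module Defs where

open import Data.Integer as ℤ using (ℤ; +_; 0ℤ; -1ℤ)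
open import Data.List using (List; foldr; map; filter; upTo; cartesianProduct)
open import Data.List.Membership.Propositional using (_∈_)
open import Data.List.Membership.Propositional.Properties
  using (∈-upTo⁺; ∈-cartesianProduct⁺; ∈-filter⁺; ∈-filter⁻)
open import Data.List.Relation.Unary.Unique.Propositional using (Unique)
import Data.List.Relation.Unary.Unique.Propositional.Properties as Unique
open import Data.Nat
open import Data.Nat.Combinatorics using (k![n∸k]!∣n!)
open import Data.Nat.Divisibility
open import Data.Nat.DivMod using (_/_; m/n*n≡m)
open import Data.Nat.Properties
open import Data.Nat.Solver using (module +-*-Solver)
open import Data.Product using (_×_; _,_; proj₁; proj₂)
open import Function.Bundles using (_⇔_; mk⇔)
open import Relation.Binary.PropositionalEquality
open import Relation.Nullary.Decidable using (_×-dec_)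
open import Relation.Unary using (Decidable)

-- Meaningful only for t ≤ n, where the division is exact (see h-exact);
-- outside that range truncated subtraction makes the value junk.
h : ℕ → ℕ → ℕ
h n t = ((2 * n + 1) * (n + t) !) / ((2 * t + 1) ! * (n ∸ t) !)
  where instance _ = (2 * t + 1) !* (n ∸ t) !≢0

private
  binomial-∣ : ∀ k d → k ! * d ! ∣ (d + k) !
  binomial-∣ k d =
    subst (λ x → k ! * x ! ∣ (d + k) !) (m+n∸n≡m d k) (k![n∸k]!∣n! (m≤n+m k d))

  -- With n = d + t and N = n + t, (2n+1) N! = (N+1)! + d N!.
  split : ∀ d t → suc (d + t + t) + d ≡ 2 * (d + t) + 1
  split = solve 2 (λ d t → (con 1 :+ (d :+ t :+ t)) :+ d
                         := con 2 :* (d :+ t) :+ con 1) refl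
    where open +-*-Solver

  shift : ∀ d t → d + (2 * t + 1) ≡ suc (d + t + t)
  shift = solve 2 (λ d t → d :+ (con 2 :* t :+ con 1)
                         := con 1 :+ (d :+ t :+ t)) refl
    where open +-*-Solver

  swap : ∀ a b c → a * (b * c) ≡ b * (a * c)
  swap = solve 3 (λ a b c → a :* (b :* c) := b :* (a :* c)) refl
    where open +-*-Solver

  first-∣ : ∀ d t → (2 * t + 1) ! * d ! ∣ suc (d + t + t) * (d + t + t) !
  first-∣ d t = subst (λ x → (2 * t + 1) ! * d ! ∣ x !) (shift d t)
                      (binomial-∣ (2 * t + 1) d)

  second-∣ : ∀ d t → (2 * t + 1) ! * d ! ∣ d * (d + t + t) !
  second-∣ zero    t = _ ∣0
  second-∣ (suc e) t =
    subst₂ (λ x y → x ∣ suc e * y !)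
           (swap (suc e) ((2 * t + 1) !) (e !)) (shift e t)
           (*-monoʳ-∣ (suc e) (binomial-∣ (2 * t + 1) e))

  h-∣′ : ∀ d t → (2 * t + 1) ! * d ! ∣ (2 * (d + t) + 1) * (d + t + t) !
  h-∣′ d t = subst (λ x → (2 * t + 1) ! * d ! ∣ x * (d + t + t) !) (split d t)
    (subst ((2 * t + 1) ! * d ! ∣_)
           (sym (*-distribʳ-+ ((d + t + t) !) (suc (d + t + t)) d))
           (∣m∣n⇒∣m+n (first-∣ d t) (second-∣ d t)))

h-exact : ∀ {n t} → t ≤ n →
          h n t * ((2 * t + 1) ! * (n ∸ t) !) ≡ (2 * n + 1) * (n + t) !
h-exact {n} {t} t≤n = m/n*n≡m
  (subst (λ x → (2 * t + 1) ! * (n ∸ t) ! ∣ (2 * x + 1) * (x + t) !)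
         (m∸n+n≡m t≤n) (h-∣′ (n ∸ t) t))
  where instance _ = (2 * t + 1) !* (n ∸ t) !≢0

∑ : {A : Set} → List A → (A → ℤ) → ℤ
∑ xs f = foldr ℤ._+_ 0ℤ (map f xs)

-- The two index sets are finite; each is listed by filtering a box that contains
-- it. The lemmas ∈-tPairs, tPairs-unique, ∈-nPairs and nPairs-unique show that
-- every admissible pair occurs exactly once.

box : ℕ → List (ℕ × ℕ)
box m = cartesianProduct (upTo (suc m)) (upTo (suc m))

private
  box-unique : ∀ m → Unique (box m)
  box-unique m = Unique.cartesianProduct⁺ (Unique.upTo⁺ (suc m)) (Unique.upTo⁺ (suc m))

  ∈-box : ∀ {m i j} → i < suc m → j < suc m → (i , j) ∈ box m
  ∈-box i< j< = ∈-cartesianProduct⁺ (∈-upTo⁺ i<) (∈-upTo⁺ j<)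

TCond : ℕ → ℕ × ℕ → Set
TCond a (t₁ , t₂) = t₁ + t₂ ≡ 2 * a

tCond? : ∀ a → Decidable (TCond a)
tCond? a (t₁ , t₂) = t₁ + t₂ ≟ 2 * a

tPairs : ℕ → List (ℕ × ℕ)
tPairs a = filter (tCond? a) (box (2 * a))

-- (n₁² + n₁ + n₂² + n₂) / 2 = n is written with the denominator cleared.
NCond : ℕ → ℕ × ℕ → ℕ × ℕ → Set
NCond n (t₁ , t₂) (n₁ , n₂) =
  t₁ ≤ n₁ × t₂ ≤ n₂ × n₁ ^ 2 + n₁ + n₂ ^ 2 + n₂ ≡ 2 * n

nCond? : ∀ n t → Decidable (NCond n t)
nCond? n (t₁ , t₂) (n₁ , n₂) =
  (t₁ ≤? n₁) ×-dec (t₂ ≤? n₂) ×-dec (n₁ ^ 2 + n₁ + n₂ ^ 2 + n₂ ≟ 2 * n)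

nPairs : ℕ → ℕ × ℕ → List (ℕ × ℕ)
nPairs n t = filter (nCond? n t) (box n)

W : ℕ → ℕ → ℤ
W a n =
  ∑ (tPairs a) λ (t₁ , t₂) →
  ∑ (nPairs n (t₁ , t₂)) λ (n₁ , n₂) →
    -1ℤ ℤ.^ (n₁ + n₂) ℤ.* + h n₁ t₁ ℤ.* + h n₂ t₂

tPairs-unique : ∀ a → Unique (tPairs a)
tPairs-unique a = Unique.filter⁺ (tCond? a) (box-unique (2 * a))

∈-tPairs : ∀ a t → t ∈ tPairs a ⇔ TCond a t
∈-tPairs a (t₁ , t₂) = mk⇔
  (λ p → proj₂ (∈-filter⁻ (tCond? a) {xs = box (2 * a)} p))
  (λ c → ∈-filter⁺ (tCond? a)
    (∈-box {2 * a}
      (s≤s (subst (t₁ ≤_) c (m≤m+n t₁ t₂)))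
      (s≤s (subst (t₂ ≤_) c (m≤n+m t₂ t₁))))
    c)

nPairs-unique : ∀ n t → Unique (nPairs n t)
nPairs-unique n t = Unique.filter⁺ (nCond? n t) (box-unique n)

private
  2m≤m²+m : ∀ m → 2 * m ≤ m ^ 2 + m
  2m≤m²+m zero    = z≤n
  2m≤m²+m (suc k) = subst₂ _≤_
    (cong (λ x → suc k + x) (sym (+-identityʳ (suc k)))) refl
    (+-monoˡ-≤ (suc k) (m≤m*n (suc k) (suc k ^ 1)))

  bound : ∀ {n} m → m ^ 2 + m ≤ 2 * n → m < suc n
  bound m p = s≤s (*-cancelˡ-≤ 2 (≤-trans (2m≤m²+m m) p))

∈-nPairs : ∀ n t m → m ∈ nPairs n t ⇔ NCond n t m
∈-nPairs n t (n₁ , n₂) = mk⇔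
  (λ p → proj₂ (∈-filter⁻ (nCond? n t) {xs = box n} p))
  (λ c → ∈-filter⁺ (nCond? n t)
    (∈-box {n}
      (bound {n} n₁ (subst (n₁ ^ 2 + n₁ ≤_) (proj₂ (proj₂ c))
        (≤-trans (m≤m+n _ (n₂ ^ 2)) (m≤m+n _ n₂))))
      (bound {n} n₂ (subst (n₂ ^ 2 + n₂ ≤_) (proj₂ (proj₂ c))
        (+-monoˡ-≤ n₂ (m≤n+m (n₂ ^ 2) (n₁ ^ 2 + n₁))))))
    c)

{-# OPTIONS --safe #-}

-- Every single summand of W is divisible by 3. Since
-- (2n₁+1)² + (2n₂+1)² = 4(n₁²+n₁+n₂²+n₂) + 2 ≡ 0 (mod 3) and −1 is not a square
-- mod 3, both 2n₁+1 and 2n₂+1 are multiples of 3. As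
-- (2t+1) h(n,t) = (2n+1) C(n+t,2t), a summand prime to 3 would force 3 to divide
-- 2t₁+1 and 2t₂+1, hence their sum 2(t₁+t₂)+2 = 4a+2, i.e. a ≡ 1 (mod 3).

module Submission where

open import Defs
open import Data.Nat using (ℕ; NonZero; _*_; _∸_)
open import Data.Integer using (+_)
open import Data.Integer.Divisibility using (_∣_)
open import Data.Product using (_×_)

open import Data.Empty using (⊥-elim)
import Data.Integer as ℤ
import Data.Integer.Divisibility.Signed as Signed
import Data.Integer.Properties as ℤ
open import Data.List using (List; []; _∷_)
open import Data.List.Membership.Propositional using (_∈_)
open import Data.List.Relation.Unary.Any using (here; there)
open import Data.Nat using (suc; _+_; _^_; _≤_; _<_; s≤s; _!)
open import Data.Nat.Combinatorics using (k![n∸k]!∣n!)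
import Data.Nat.Divisibility as ℕ
open import Data.Nat.DivMod using (_%_; m%n<n; %-distribˡ-+; %-distribˡ-*)
open import Data.Nat.Primality using (Prime; prime?; euclidsLemma)
open import Data.Nat.Properties
open import Data.Nat.Solver using (module +-*-Solver)
open import Data.Product using (_,_; proj₁; proj₂)
open import Data.Sum using (_⊎_; inj₁; inj₂)
open import Function.Bundles using (module Equivalence)
open import Relation.Binary.PropositionalEquality
open import Relation.Nullary using (¬_)
open import Relation.Nullary.Decidable using (from-yes; from-no)

open +-*-Solver

∣-∑ : ∀ {A : Set} d (xs : List A) (f : A → ℤ.ℤ) →
      (∀ {x} → x ∈ xs → d ∣ f x) → d ∣ ∑ xs f
∣-∑ d []       f d∣f = ℕ._∣0 _
∣-∑ d (x ∷ xs) f d∣f = Signed.∣⇒∣ᵤ {d} (Signed.∣m∣n⇒∣m+n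
  (Signed.∣ᵤ⇒∣ {d} {f x} (d∣f (here refl)))
  (Signed.∣ᵤ⇒∣ {d} {∑ xs f} (∣-∑ d xs f (λ x∈xs → d∣f (there x∈xs)))))

prime-3 : Prime 3
prime-3 = from-yes (prime? 3)

residues-3 : ∀ r s → r < 3 → s < 3 → ((r * r) % 3 + (s * s) % 3) % 3 ≡ 0 →
             r ≡ 0 × s ≡ 0
residues-3 0 0 _ _ _  = refl , refl
residues-3 0 1 _ _ ()
residues-3 0 2 _ _ ()
residues-3 1 0 _ _ ()
residues-3 1 1 _ _ ()
residues-3 1 2 _ _ ()
residues-3 2 0 _ _ ()
residues-3 2 1 _ _ ()
residues-3 2 2 _ _ ()
residues-3 (suc (suc (suc _))) _ (s≤s (s≤s (s≤s ()))) _ _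
residues-3 _ (suc (suc (suc _))) _ (s≤s (s≤s (s≤s ()))) _

3∣x²+y²⇒3∣x×3∣y : ∀ x y → 3 ℕ.∣ x * x + y * y → 3 ℕ.∣ x × 3 ℕ.∣ y
3∣x²+y²⇒3∣x×3∣y x y 3∣ = ℕ.m%n≡0⇒n∣m x 3 (proj₁ zeros) , ℕ.m%n≡0⇒n∣m y 3 (proj₂ zeros)
  where
  zeros : x % 3 ≡ 0 × y % 3 ≡ 0
  zeros = residues-3 (x % 3) (y % 3) (m%n<n x 3) (m%n<n y 3) (begin
    ((x % 3 * (x % 3)) % 3 + (y % 3 * (y % 3)) % 3) % 3
      ≡⟨ cong₂ (λ u v → (u + v) % 3) (%-distribˡ-* x x 3) (%-distribˡ-* y y 3) ⟨
    ((x * x) % 3 + (y * y) % 3) % 3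
      ≡⟨ %-distribˡ-+ (x * x) (y * y) 3 ⟨
    (x * x + y * y) % 3
      ≡⟨ ℕ.n∣m⇒m%n≡0 _ 3 3∣ ⟩
    0 ∎)
    where open ≡-Reasoning

3∣odd-parts : ∀ N n₁ n₂ → 3 ℕ.∣ 4 * (2 * N) + 2 →
              n₁ ^ 2 + n₁ + n₂ ^ 2 + n₂ ≡ 2 * N →
              3 ℕ.∣ 2 * n₁ + 1 × 3 ℕ.∣ 2 * n₂ + 1
3∣odd-parts N n₁ n₂ 3∣ eq = 3∣x²+y²⇒3∣x×3∣y (2 * n₁ + 1) (2 * n₂ + 1)
  (subst (3 ℕ.∣_) (trans (cong (λ s → 4 * s + 2) (sym eq)) (complete-squares n₁ n₂)) 3∣)
  where
  complete-squares : ∀ u v → 4 * (u ^ 2 + u + v ^ 2 + v) + 2 ≡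
                     (2 * u + 1) * (2 * u + 1) + (2 * v + 1) * (2 * v + 1)
  complete-squares = solve 2 (λ u v →
    con 4 :* (u :^ 2 :+ u :+ v :^ 2 :+ v) :+ con 2 :=
    (con 2 :* u :+ con 1) :* (con 2 :* u :+ con 1) :+
    (con 2 :* v :+ con 1) :* (con 2 :* v :+ con 1)) refl

2n+1∣h*[2t+1] : ∀ {n t} → t ≤ n → 2 * n + 1 ℕ.∣ h n t * (2 * t + 1)
2n+1∣h*[2t+1] {n} {t} t≤n = ℕ.divides c (*-cancelʳ-≡ _ _ F (begin
  h n t * (2 * t + 1) * F
    ≡⟨ solve 4 (λ a b x y → a :* b :* (x :* y) := a :* (b :* x :* y)) refl
         (h n t) (2 * t + 1) ((2 * t) !) ((n ∸ t) !) ⟩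
  h n t * ((2 * t + 1) * (2 * t) ! * (n ∸ t) !)
    ≡⟨ cong (λ x → h n t * (x * (n ∸ t) !)) odd! ⟨
  h n t * ((2 * t + 1) ! * (n ∸ t) !)
    ≡⟨ h-exact t≤n ⟩
  (2 * n + 1) * (n + t) !
    ≡⟨ cong ((2 * n + 1) *_) (ℕ._∣_.equality F∣) ⟩
  (2 * n + 1) * (c * F)
    ≡⟨ solve 3 (λ a b f → a :* (b :* f) := b :* a :* f) refl (2 * n + 1) c F ⟩
  c * (2 * n + 1) * F ∎))
  where
  open ≡-Reasoning
  F = (2 * t) ! * (n ∸ t) !
  instance F≢0 = (2 * t) !* (n ∸ t) !≢0

  odd! : (2 * t + 1) ! ≡ (2 * t + 1) * (2 * t) !
  odd! rewrite +-comm (2 * t) 1 = refl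

  2t≡t+t : 2 * t ≡ t + t
  2t≡t+t = cong (λ x → t + x) (+-identityʳ t)

  n+t∸2t : n + t ∸ 2 * t ≡ n ∸ t
  n+t∸2t = trans (cong₂ _∸_ (+-comm n t) 2t≡t+t) ([m+n]∸[m+o]≡n∸o t n t)

  F∣ : F ℕ.∣ (n + t) !
  F∣ = subst (λ x → (2 * t) ! * x ! ℕ.∣ (n + t) !) n+t∸2t
    (k![n∸k]!∣n! (subst (_≤ n + t) (sym 2t≡t+t) (+-monoˡ-≤ t t≤n)))

  c = ℕ._∣_.quotient F∣

3∣h⊎3∣2t+1 : ∀ {n t} → t ≤ n → 3 ℕ.∣ 2 * n + 1 → 3 ℕ.∣ h n t ⊎ 3 ℕ.∣ 2 * t + 1
3∣h⊎3∣2t+1 {n} {t} t≤n 3∣2n+1 =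
  euclidsLemma (h n t) (2 * t + 1) prime-3 (ℕ.∣-trans 3∣2n+1 (2n+1∣h*[2t+1] t≤n))

3∣h*h : ∀ {a n₁ n₂ t₁ t₂} → ¬ 3 ℕ.∣ 4 * a + 2 → t₁ + t₂ ≡ 2 * a →
        t₁ ≤ n₁ → t₂ ≤ n₂ → 3 ℕ.∣ 2 * n₁ + 1 → 3 ℕ.∣ 2 * n₂ + 1 →
        3 ℕ.∣ h n₁ t₁ * h n₂ t₂
3∣h*h {a} {n₁} {n₂} {t₁} {t₂} 3∤ teq t₁≤ t₂≤ d₁ d₂
  with 3∣h⊎3∣2t+1 t₁≤ d₁ | 3∣h⊎3∣2t+1 t₂≤ d₂
... | inj₁ p | _      = ℕ.∣m⇒∣m*n (h n₂ t₂) p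
... | inj₂ _ | inj₁ q = ℕ.∣n⇒∣m*n (h n₁ t₁) q
... | inj₂ p | inj₂ q = ⊥-elim (3∤ (subst (3 ℕ.∣_) sum-eq (ℕ.∣m∣n⇒∣m+n p q)))
  where
  open ≡-Reasoning
  sum-eq : 2 * t₁ + 1 + (2 * t₂ + 1) ≡ 4 * a + 2
  sum-eq = begin
    2 * t₁ + 1 + (2 * t₂ + 1)
      ≡⟨ solve 2 (λ s t → con 2 :* s :+ con 1 :+ (con 2 :* t :+ con 1)
                       := con 2 :* (s :+ t) :+ con 2) refl t₁ t₂ ⟩
    2 * (t₁ + t₂) + 2
      ≡⟨ cong (λ s → 2 * s + 2) teq ⟩
    2 * (2 * a) + 2
      ≡⟨ cong (_+ 2) (*-assoc 2 2 a) ⟨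
    4 * a + 2 ∎

3∣W : ∀ a n → ¬ 3 ℕ.∣ 4 * a + 2 → 3 ℕ.∣ 4 * (2 * n) + 2 → + 3 ∣ W a n
3∣W a n 3∤ 3∣ = ∣-∑ (+ 3) (tPairs a) _ λ {(t₁ , t₂)} t∈ →
  ∣-∑ (+ 3) (nPairs n (t₁ , t₂)) _ λ {(n₁ , n₂)} n∈ →
  let teq             = Equivalence.to (∈-tPairs a _) t∈
      t₁≤ , t₂≤ , neq = Equivalence.to (∈-nPairs n (t₁ , t₂) _) n∈
      d₁ , d₂         = 3∣odd-parts n n₁ n₂ 3∣ neq
      sign            = ℤ.-1ℤ ℤ.^ (n₁ + n₂)
  in subst (3 ℕ.∣_) (sym (abs-summand sign (h n₁ t₁) (h n₂ t₂)))
       (ℕ.∣n⇒∣m*n ℤ.∣ sign ∣ (3∣h*h {a} 3∤ teq t₁≤ t₂≤ d₁ d₂))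
  where
  abs-summand : ∀ s x y → ℤ.∣ s ℤ.* + x ℤ.* + y ∣ ≡ ℤ.∣ s ∣ * (x * y)
  abs-summand s x y = begin
    ℤ.∣ s ℤ.* + x ℤ.* + y ∣  ≡⟨ ℤ.abs-* (s ℤ.* + x) (+ y) ⟩
    ℤ.∣ s ℤ.* + x ∣ * y      ≡⟨ cong (_* y) (ℤ.abs-* s (+ x)) ⟩
    ℤ.∣ s ∣ * x * y          ≡⟨ *-assoc ℤ.∣ s ∣ x y ⟩
    ℤ.∣ s ∣ * (x * y)        ∎
    where open ≡-Reasoning

3k+r-∤ : ∀ {m} k r → ¬ 3 ℕ.∣ r → m ≡ k * 3 + r → ¬ 3 ℕ.∣ m
3k+r-∤ k r 3∤r refl 3∣m = 3∤r (ℕ.∣m+n∣m⇒∣n 3∣m (ℕ.n∣m*n k))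

3[1+b]∸1 : ∀ b → 3 * suc b ∸ 1 ≡ 3 * b + 2
3[1+b]∸1 b = cong (_∸ 1)
  (solve 1 (λ b → con 3 :* (con 1 :+ b) := con 1 :+ (con 3 :* b :+ con 2)) refl b)

lemma3p3 : (a n : ℕ) → .{{_ : NonZero a}} → .{{_ : NonZero n}} →
    (+ 3 ∣ W (3 * a) (3 * n ∸ 1)) × (+ 3 ∣ W (3 * a ∸ 1) (3 * n ∸ 1))
lemma3p3 a@(suc b) n@(suc m) =
  3∣W (3 * a) (3 * n ∸ 1) 3∤₀ 3∣N , 3∣W (3 * a ∸ 1) (3 * n ∸ 1) 3∤₁ 3∣N
  where
  3∤₀ : ¬ 3 ℕ.∣ 4 * (3 * a) + 2
  3∤₀ = 3k+r-∤ (4 * a) 2 (from-no (3 ℕ.∣? 2))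
    (solve 1 (λ a → con 4 :* (con 3 :* a) :+ con 2 := con 4 :* a :* con 3 :+ con 2) refl a)

  3∤₁ : ¬ 3 ℕ.∣ 4 * (3 * a ∸ 1) + 2
  3∤₁ = 3k+r-∤ (4 * b) 10 (from-no (3 ℕ.∣? 10))
    (trans (cong (λ x → 4 * x + 2) (3[1+b]∸1 b))
      (solve 1 (λ b → con 4 :* (con 3 :* b :+ con 2) :+ con 2
                   := con 4 :* b :* con 3 :+ con 10) refl b))

  3∣N : 3 ℕ.∣ 4 * (2 * (3 * n ∸ 1)) + 2
  3∣N = ℕ.divides (8 * m + 6)
    (trans (cong (λ x → 4 * (2 * x) + 2) (3[1+b]∸1 m))
      (solve 1 (λ m → con 4 :* (con 2 :* (con 3 :* m :+ con 2)) :+ con 2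
                   := (con 8 :* m :+ con 6) :* con 3) refl m))
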